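{- There exists an algorithm, with running time polynomial in $n$, that takes as input $m,n\in\mathbb{N}$ with $m\le n$ and a zero-set $\mathcal{Z}$ with $\mathcal{Z}\subseteq R_{n,m}$, and returns a number in the interval $[\gamma,3\gamma]$, where $\gamma=\gamma(\mathcal{Z},m,n)$.
   Context: $\mathbb{Z}_+=\{0,1,2,\dots\}$, $\mathbb{N}=\{1,2,\dots\}$, $[0,c]=\{0,1,\dots,c\}$, and $R_{a,b}=[0,a-1]\times[0,b-1]$. A zero-set (Young diagram) is a downward-closed set $\mathcal{Z}\subseteq\mathbb{Z}_+^2$. For $m,n\in\mathbb{N}$, the graph $K_m\Box K_n$ is represented on the vertex set $R_{n,m}=[0,n-1]\times[0,m-1]$, with two vertices adjacent iff they differ in exactly one coordinate. For $v=(j,i)\in R_{n,m}$, the row neighborhood $\mathcal{N}^r(v)$ is the set of all $(j',i)\in R_{n,m}$ with $j'\neq j$, and the column neighborhood $\mathcal{N}^c(v)$ is the set of all $(j,i')\in R_{n,m}$ with $i'\ne i$. Given $\mathcal{Z}$, for $A\subseteq R_{n,m}$ let $\mathcal{T}(A)=A\cup\{v\in R_{n,m}\setminus A\colon (|\mathcal{N}^r(v)\cap A|,|\mathcal{N}^c(v)\cap A|)\notin\mathcal{Z}\}$. Then $\gamma(\mathcal{Z},m,n)=\min\{|A|\colon A\subseteq R_{n,m},\ \mathcal{T}(A)=R_{n,m}\}$. -}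

module Defs where

open import Data.Bool using (if_then_else_)
import Data.Bool as Bool
open import Data.Fin using (Fin; remQuot)
import Data.Fin.Properties as Fin
open import Data.Fin.Subset using (Subset; ⊤; ∁; _∩_; _∪_; ∣_∣)
open import Data.Fin.Subset.Properties using (anySubset?; ∪-zeroˡ)
open import Data.Nat using (ℕ; zero; suc; _+_; _*_; _∸_; _≤_; _<_; z≤n; s≤s; _≟_; _/_; _%_; NonZero)
open import Data.Product using (∃; _×_; _,_; proj₁)
open import Data.Vec using (tabulate)
import Data.Vec.Properties as Vec
open import Function using (_∘_)
open import Relation.Binary.PropositionalEquality using (_≡_; _≢_; refl)
open import Relation.Nullary using (yes; no; does; ¬?; _×-dec_; contradiction)
open import Relation.Unary using (Pred; Decidable)
open import Level using (0ℓ)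

------------------------------------------------------------------------
-- Zero-sets

R : ℕ → ℕ → Pred (ℕ × ℕ) 0ℓ
R a b (x , y) = x < a × y < b

-- Membership is decidable because a zero-set has to be written down as
-- the input of an algorithm.
record ZeroSet : Set₁ where
  field
    Carrier  : Pred (ℕ × ℕ) 0ℓ
    _∈?      : Decidable Carrier
    downward : ∀ {x y x′ y′} → x′ ≤ x → y′ ≤ y →
               Carrier (x , y) → Carrier (x′ , y′)

------------------------------------------------------------------------
-- Growth on the Hamming graph

module Hamming (n m : ℕ) where

  -- A vertex (j , i) has column index j and row index i, so it moves along
  -- its row as j varies.
  Vertex : Set
  Vertex = Fin n × Fin m

  -- Subsets of the vertex set, through the bijection Fin (n * m) ↔ Vertex.
  VertexSet : Set
  VertexSet = Subset (n * m)

  ⟪_⟫ : {P : Pred Vertex 0ℓ} → Decidable P → VertexSet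
  ⟪ P? ⟫ = tabulate (does ∘ P? ∘ remQuot {n} m)

  𝒩ʳ : Vertex → VertexSet
  𝒩ʳ (j , i) = ⟪ (λ (j′ , i′) → ¬? (j′ Fin.≟ j) ×-dec (i′ Fin.≟ i)) ⟫

  𝒩ᶜ : Vertex → VertexSet
  𝒩ᶜ (j , i) = ⟪ (λ (j′ , i′) → (j′ Fin.≟ j) ×-dec ¬? (i′ Fin.≟ i)) ⟫

  𝒯 : ZeroSet → VertexSet → VertexSet
  𝒯 Z A = A ∪ (∁ A ∩ ⟪ (λ v → ¬? ((∣ 𝒩ʳ v ∩ A ∣ , ∣ 𝒩ᶜ v ∩ A ∣) ∈?)) ⟫)
    where open ZeroSet Z

------------------------------------------------------------------------
-- γ

IsMinimum : Pred ℕ 0ℓ → Pred ℕ 0ℓ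
IsMinimum P k = P k × (∀ {l} → P l → k ≤ l)

minimum : ∀ {P} → Decidable P → ∃ P → ∃ (IsMinimum P)
minimum {P} P? (b , p) = search P? b p
  where
  search : ∀ {Q} → Decidable Q → ∀ b → Q b → ∃ (IsMinimum Q)
  search Q? zero    q = zero , q , λ _ → z≤n
  search {Q} Q? (suc b) q with Q? zero
  ... | yes q₀ = zero , q₀ , λ _ → z≤n
  ... | no ¬q₀ with k , qₖ , least ← search (Q? ∘ suc) b q =
    suc k , qₖ , λ { {zero} q₀ → contradiction q₀ ¬q₀ ; {suc _} q′ → s≤s (least q′) }

-- k is the size of some A with 𝒯(A) equal to the whole vertex set.
SpanningSize : ZeroSet → ℕ → ℕ → Pred ℕ 0ℓ
SpanningSize Z m n k = ∃ λ (A : VertexSet) → ∣ A ∣ ≡ k × 𝒯 Z A ≡ ⊤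
  where open Hamming n m

γ-minimum : ∀ Z m n → ∃ (IsMinimum (SpanningSize Z m n))
γ-minimum Z m n = minimum
  (λ k → anySubset? λ A → (∣ A ∣ ≟ k) ×-dec Vec.≡-dec Bool._≟_ (𝒯 Z A) ⊤)
  (∣ ⊤ {n * m} ∣ , ⊤ , refl , ∪-zeroˡ _)
  where open Hamming n m

γ : ZeroSet → ℕ → ℕ → ℕ
γ Z m n = proj₁ (γ-minimum Z m n)

------------------------------------------------------------------------
-- Algorithms
--
-- Structured programs for a random access machine with finitely many named
-- registers and arrays. The only arithmetic is addition and truncated
-- subtraction, so with every operation charged one unit of time, t steps
-- produce numbers of O(t + size of the input) bits, and polynomial time
-- coincides with polynomial time on a Turing machine. Unit-cost
-- multiplication would break this.

infixl 6 _⊕_ _⊖_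
infix  7 _[_]

data Expr : Set where
  const   : ℕ → Expr
  reg     : ℕ → Expr
  _[_]    : ℕ → Expr → Expr
  _⊕_ _⊖_ : Expr → Expr → Expr

infix  4 _≔_ _[_]≔_
infixr 3 _⨟_

data Program : Set where
  skip          : Program
  _≔_           : ℕ → Expr → Program
  _[_]≔_        : ℕ → Expr → Expr → Program
  _⨟_           : Program → Program → Program
  If_Then_Else_ : Expr → Program → Program → Program
  While_Do_     : Expr → Program → Program

record State : Set where
  constructor ⟨_,_⟩
  field
    regs : ℕ → ℕ
    arrs : ℕ → ℕ → ℕ
open State public

_[_↦_] : ∀ {A : Set} → (ℕ → A) → ℕ → A → (ℕ → A)
(f [ x ↦ a ]) y = if does (y ≟ x) then a else f y

setReg : ℕ → ℕ → State → State
setReg x v s = ⟨ regs s [ x ↦ v ] , arrs s ⟩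

setArr : ℕ → ℕ → ℕ → State → State
setArr a k v s = ⟨ regs s , arrs s [ a ↦ arrs s a [ k ↦ v ] ] ⟩

⟦_⟧ : Expr → State → ℕ
⟦ const c ⟧ s = c
⟦ reg x   ⟧ s = regs s x
⟦ a [ e ] ⟧ s = arrs s a (⟦ e ⟧ s)
⟦ d ⊕ e   ⟧ s = ⟦ d ⟧ s + ⟦ e ⟧ s
⟦ d ⊖ e   ⟧ s = ⟦ d ⟧ s ∸ ⟦ e ⟧ s

cost : Expr → ℕ
cost (const _) = 1
cost (reg _)   = 1
cost (_ [ e ]) = 1 + cost e
cost (d ⊕ e)   = 1 + cost d + cost e
cost (d ⊖ e)   = 1 + cost d + cost e

-- p , s ⇓[ t ] s′: started in state s, the program p halts in state s′
-- after time t. A test succeeds when its value is nonzero.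
infix 2 _,_⇓[_]_

data _,_⇓[_]_ : Program → State → ℕ → State → Set where
  ⇓skip   : ∀ {s} → skip , s ⇓[ 1 ] s
  ⇓reg    : ∀ {x e s} → (x ≔ e) , s ⇓[ 1 + cost e ] setReg x (⟦ e ⟧ s) s
  ⇓arr    : ∀ {a d e s} →
            (a [ d ]≔ e) , s ⇓[ 1 + cost d + cost e ] setArr a (⟦ d ⟧ s) (⟦ e ⟧ s) s
  ⇓seq    : ∀ {p q s s′ s″ t u} →
            p , s ⇓[ t ] s′ → q , s′ ⇓[ u ] s″ → (p ⨟ q) , s ⇓[ t + u ] s″
  ⇓then   : ∀ {e p q s s′ t} → ⟦ e ⟧ s ≢ 0 →
            p , s ⇓[ t ] s′ → (If e Then p Else q) , s ⇓[ 1 + cost e + t ] s′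
  ⇓else   : ∀ {e p q s s′ t} → ⟦ e ⟧ s ≡ 0 →
            q , s ⇓[ t ] s′ → (If e Then p Else q) , s ⇓[ 1 + cost e + t ] s′
  ⇓while  : ∀ {e p s s′ s″ t u} → ⟦ e ⟧ s ≢ 0 →
            p , s ⇓[ t ] s′ → (While e Do p) , s′ ⇓[ u ] s″ →
            (While e Do p) , s ⇓[ 1 + cost e + t + u ] s″
  ⇓done   : ∀ {e p s} → ⟦ e ⟧ s ≡ 0 → (While e Do p) , s ⇓[ 1 + cost e ] s

-- m and n are in registers 0 and 1, and array 0 is the row-by-row membership
-- table of Z: cell y * n + x, for x < n, is 1 if (x , y) ∈ Z and 0 otherwise.
-- When Z ⊆ R n m, all cells from m * n on are 0, so the input is finite.
input : (m n : ℕ) .{{_ : NonZero n}} → ZeroSet → State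
input m n Z = ⟨ registers , arrays ⟩
  where
  open ZeroSet Z

  registers : ℕ → ℕ
  registers 0 = m
  registers 1 = n
  registers _ = 0

  arrays : ℕ → ℕ → ℕ
  arrays 0 k = if does ((k % n , k / n) ∈?) then 1 else 0
  arrays _ _ = 0

output : State → ℕ
output s = regs s 0

{-# OPTIONS --safe #-}
module Submission where

import Algebra.Properties.Semiring.Sum as SemiringSum
open import Data.Bool using (Bool; true; false; _∧_; if_then_else_)
open import Data.Fin using (Fin; zero; suc; toℕ; _↑ˡ_; _↑ʳ_; remQuot)
import Data.Fin.Properties as Fin
open import Data.Fin.Subset using (Subset; inside; outside; ⊤; ∁; _∈_; _∩_; _∪_; ∣_∣)
  renaming (_⊆_ to _⊆ˢ_)
open import Data.Fin.Subset.Properties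
  using (_∈?_; ∈⊤; ⊆⊤; ⊆-antisym; p⊆q⇒∣p∣≤∣q∣; ∣p∣≤n; ∣⊤∣≡n; x∈p∩q⁺;
         x∈p∩q⁻; x∈p∪q⁺; x∈p∪q⁻; x∉p⇒x∈∁p; ∪-zeroˡ)
open import Data.Nat
open import Data.Nat.DivMod using (m<n⇒m%n≡m; m<n⇒m/n≡0; m*n/n≡m; [m+kn]%n≡m%n; +-distrib-/-∣ˡ)
open import Data.Nat.Divisibility using (n∣m*n)
open import Data.Nat.Properties
open import Data.Nat.Solver using (module +-*-Solver)
open import Data.Product using (∃; _×_; _,_; proj₁; proj₂; map₁)
open import Data.Sum using (_⊎_; inj₁; inj₂)
open import Data.Vec using ([]; _∷_; lookup; tabulate)
open import Data.Vec.Properties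
  using (lookup∘tabulate; tabulate∘lookup; lookup-zipWith; lookup⇒[]=; []=⇒lookup)
open import Function using (_∘_; mk⇔)
open import Level using (0ℓ)
open import Relation.Binary.PropositionalEquality hiding ([_])
open import Relation.Nullary using (¬_; Dec; yes; no; does; ¬?; _×-dec_; _⊎-dec_; contradiction)
open import Relation.Nullary.Decidable using (dec-true; does-⇔)
open import Relation.Unary using (Pred; Decidable; U; _⊆_)
open import Relation.Unary.Properties using (U?)
open import Defs

-- The minimum f of n * m and of all weights a * m + b * n with (a , b) ∉ Z,
-- a < n and b < m satisfies γ ≤ f ≤ 3γ, and two nested loops compute it.
-- Upper bound on γ: if (a , b) ∉ Z, then a full columns together with b full
-- rows span. Lower bound: let A span, and let r(v), c(v) be the numbers of
-- neighbours of v in A along its row and column. Each vertex satisfies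
-- f ≤ r(v) * m + c(v) * n + [v ∈ A] * n * m, since either v ∈ A or
-- (r(v) , c(v)) ∉ Z. Summed over all n * m vertices the right-hand side is at
-- most 3 * n * m * ∣ A ∣, because a row has n vertices and a column m.

-- Finite sums

open SemiringSum +-*-semiring
  using (sum-syntax; sum-cong-≗; ∑-distrib-+; ∑-comm; *-distribˡ-sum; *-distribʳ-sum)

∑-mono : ∀ {n} {f g : Fin n → ℕ} → (∀ k → f k ≤ g k) → ∑[ k < n ] f k ≤ ∑[ k < n ] g k
∑-mono {zero}  f≤g = z≤n
∑-mono {suc n} f≤g = +-mono-≤ (f≤g zero) (∑-mono (f≤g ∘ suc))

∑-const : ∀ n c → ∑[ _ < n ] c ≡ n * c
∑-const zero    c = refl
∑-const (suc n) c = cong (c +_) (∑-const n c)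

∑-++ : ∀ m {n} (f : Fin (m + n) → ℕ) →
       ∑[ k < m + n ] f k ≡ ∑[ i < m ] f (i ↑ˡ n) + ∑[ j < n ] f (m ↑ʳ j)
∑-++ zero    f = refl
∑-++ (suc m) f = trans (cong (f zero +_) (∑-++ m (f ∘ suc))) (sym (+-assoc (f zero) _ _))

-- Induction on `n`: the first `m` flat indices are the vertices with first coordinate `zero`, and
-- the remaining ones are the same enumeration for `n` with that coordinate shifted by `suc`.
∑-remQuot : ∀ n m (f : Fin n × Fin m → ℕ) →
            ∑[ k < n * m ] f (remQuot {n} m k) ≡ ∑[ j < n ] ∑[ i < m ] f (j , i)
∑-remQuot zero    m f = refl
∑-remQuot (suc n) m f = begin
  ∑[ k < m + n * m ] f (remQuot {suc n} m k)
    ≡⟨ ∑-++ m (f ∘ remQuot {suc n} m) ⟩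
  ∑[ i < m ] f (remQuot {suc n} m (i ↑ˡ n * m)) + ∑[ k < n * m ] f (remQuot {suc n} m (m ↑ʳ k))
    ≡⟨ cong₂ _+_ (sum-cong-≗ head≗) (sum-cong-≗ tail≗) ⟩
  ∑[ i < m ] f (zero , i) + ∑[ k < n * m ] f (map₁ suc (remQuot {n} m k))
    ≡⟨ cong (∑[ i < m ] f (zero , i) +_) (∑-remQuot n m (f ∘ map₁ suc)) ⟩
  ∑[ i < m ] f (zero , i) + ∑[ j < n ] ∑[ i < m ] f (suc j , i) ∎
  where
  open ≡-Reasoning

  head≗ : ∀ i → f (remQuot {suc n} m (i ↑ˡ n * m)) ≡ f (zero , i)
  head≗ i rewrite Fin.splitAt-↑ˡ m i (n * m) = refl

  tail≗ : ∀ k → f (remQuot {suc n} m (m ↑ʳ k)) ≡ f (map₁ suc (remQuot {n} m k))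
  tail≗ k rewrite Fin.splitAt-↑ʳ m (n * m) k = refl

-- Cardinalities of finite subsets

indicator : Bool → ℕ
indicator b = if b then 1 else 0

indicator-∧ : ∀ b c → indicator (b ∧ c) ≡ indicator b * indicator c
indicator-∧ true  c = sym (+-identityʳ _)
indicator-∧ false c = refl

∣tabulate∣ : ∀ {n} (f : Fin n → Bool) → ∣ tabulate f ∣ ≡ ∑[ k < n ] indicator (f k)
∣tabulate∣ {zero}  f = refl
∣tabulate∣ {suc n} f with f zero
... | true  = cong suc (∣tabulate∣ (f ∘ suc))
... | false = ∣tabulate∣ (f ∘ suc)

∣p∣≡∑ : ∀ {n} (p : Subset n) → ∣ p ∣ ≡ ∑[ k < n ] indicator (lookup p k)
∣p∣≡∑ p = trans (cong ∣_∣ (sym (tabulate∘lookup p))) (∣tabulate∣ (lookup p))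

∣p∪q∣≤∣p∣+∣q∣ : ∀ {n} (p q : Subset n) → ∣ p ∪ q ∣ ≤ ∣ p ∣ + ∣ q ∣
∣p∪q∣≤∣p∣+∣q∣ []            []            = z≤n
∣p∪q∣≤∣p∣+∣q∣ (outside ∷ p) (outside ∷ q) = ∣p∪q∣≤∣p∣+∣q∣ p q
∣p∪q∣≤∣p∣+∣q∣ (outside ∷ p) (inside  ∷ q) =
  ≤-trans (s≤s (∣p∪q∣≤∣p∣+∣q∣ p q)) (≤-reflexive (sym (+-suc ∣ p ∣ ∣ q ∣)))
∣p∪q∣≤∣p∣+∣q∣ (inside  ∷ p) (outside ∷ q) = s≤s (∣p∪q∣≤∣p∣+∣q∣ p q)
∣p∪q∣≤∣p∣+∣q∣ (inside  ∷ p) (inside  ∷ q) =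
  s≤s (≤-trans (∣p∪q∣≤∣p∣+∣q∣ p q) (+-monoʳ-≤ ∣ p ∣ (n≤1+n ∣ q ∣)))

∣_∣ᵖ : ∀ {n} {P : Pred (Fin n) 0ℓ} → Decidable P → ℕ
∣ P? ∣ᵖ = ∣ tabulate (does ∘ P?) ∣

∣≟∣ : ∀ {n} (i : Fin n) → ∣ Fin._≟ i ∣ᵖ ≡ 1
∣≟∣ {suc n} zero    = cong suc (trans (∣tabulate∣ {n} (λ _ → false)) (trans (∑-const n 0) (*-zeroʳ n)))
∣≟∣ {suc n} (suc i) = ∣≟∣ i

∣<∣ : ∀ {n a} → a ≤ n → ∣ (λ (j : Fin n) → toℕ j <? a) ∣ᵖ ≡ a
∣<∣ {n}     z≤n       = trans (∣tabulate∣ {n} (λ _ → false)) (trans (∑-const n 0) (*-zeroʳ n))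
∣<∣ {suc n} (s≤s a≤n) = cong suc (∣<∣ a≤n)

∣U∣ : ∀ n → ∣ U? {A = Fin n} ∣ᵖ ≡ n
∣U∣ n = trans (∣tabulate∣ {n} (λ _ → true)) (trans (∑-const n 1) (*-identityʳ n))

-- Double counting of the pairs (k , l) with l ∈ F k and l ∈ A.
∑-∣∩∣≤ : ∀ {K d} (F : Fin K → Subset K) → (∀ k l → lookup (F k) l ≡ lookup (F l) k) →
         (∀ k → ∣ F k ∣ ≤ d) → (A : Subset K) → ∑[ k < K ] ∣ F k ∩ A ∣ ≤ d * ∣ A ∣
∑-∣∩∣≤ {K} {d} F symF F≤d A = begin
  ∑[ k < K ] ∣ F k ∩ A ∣
    ≡⟨ sum-cong-≗ (λ k → trans (∣p∣≡∑ (F k ∩ A)) (sum-cong-≗ (split k))) ⟩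
  ∑[ k < K ] ∑[ l < K ] (indicator (lookup (F l) k) * indicator (lookup A l))
    ≡⟨ ∑-comm (λ k l → indicator (lookup (F l) k) * indicator (lookup A l)) ⟩
  ∑[ l < K ] ∑[ k < K ] (indicator (lookup (F l) k) * indicator (lookup A l))
    ≡⟨ sum-cong-≗ (λ l → *-distribʳ-sum _ (λ k → indicator (lookup (F l) k))) ⟨
  ∑[ l < K ] (∑[ k < K ] indicator (lookup (F l) k) * indicator (lookup A l))
    ≡⟨ sum-cong-≗ (λ l → cong (_* indicator (lookup A l)) (∣p∣≡∑ (F l))) ⟨
  ∑[ l < K ] (∣ F l ∣ * indicator (lookup A l))
    ≤⟨ ∑-mono (λ l → *-monoˡ-≤ _ (F≤d l)) ⟩
  ∑[ l < K ] (d * indicator (lookup A l))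
    ≡⟨ *-distribˡ-sum d (λ l → indicator (lookup A l)) ⟨
  d * ∑[ l < K ] indicator (lookup A l)
    ≡⟨ cong (d *_) (∣p∣≡∑ A) ⟨
  d * ∣ A ∣ ∎
  where
  open ≤-Reasoning

  -- Symmetry enters here: `F k` is traded for `F l`, so that after the sums are exchanged the inner
  -- one is the size of `F l`.
  split : ∀ k l → indicator (lookup (F k ∩ A) l) ≡ indicator (lookup (F l) k) * indicator (lookup A l)
  split k l = begin-equality
    indicator (lookup (F k ∩ A) l)
      ≡⟨ cong indicator (lookup-zipWith _∧_ l (F k) A) ⟩
    indicator (lookup (F k) l ∧ lookup A l)
      ≡⟨ indicator-∧ (lookup (F k) l) (lookup A l) ⟩
    indicator (lookup (F k) l) * indicator (lookup A l)
      ≡⟨ cong (λ b → indicator b * indicator (lookup A l)) (symF k l) ⟩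
    indicator (lookup (F l) k) * indicator (lookup A l) ∎

-- Rectangles and neighbourhoods in the Hamming graph

module _ (n m : ℕ) where
  open Hamming n m

  private
    vertex : Fin (n * m) → Vertex
    vertex = remQuot {n} m

  ∈⟪⟫⁺ : ∀ {P : Pred Vertex 0ℓ} (P? : Decidable P) {k} → P (vertex k) → k ∈ ⟪ P? ⟫
  ∈⟪⟫⁺ P? {k} p = lookup⇒[]= k _ (trans (lookup∘tabulate _ k) (dec-true (P? (vertex k)) p))

  ∈⟪⟫⁻ : ∀ {P : Pred Vertex 0ℓ} (P? : Decidable P) {k} → k ∈ ⟪ P? ⟫ → P (vertex k)
  ∈⟪⟫⁻ P? {k} k∈ with P? (vertex k) in eq
  ... | yes p = p
  ... | no ¬p = contradiction
    (trans (sym ([]=⇒lookup k∈)) (trans (lookup∘tabulate _ k) (cong does eq))) λ ()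

  -- The indicator of a conjunction is a product, so the double sum factors. Neighbourhoods, blocks
  -- of full rows or columns, and their traces on a single line are all rectangles, and are all
  -- counted this way.
  ∣rectangle∣ : ∀ {P : Pred (Fin n) 0ℓ} {Q : Pred (Fin m) 0ℓ} (P? : Decidable P) (Q? : Decidable Q) →
                ∣ ⟪ (λ (j , i) → P? j ×-dec Q? i) ⟫ ∣ ≡ ∣ P? ∣ᵖ * ∣ Q? ∣ᵖ
  ∣rectangle∣ P? Q? = begin
    ∣ ⟪ (λ (j , i) → P? j ×-dec Q? i) ⟫ ∣
      ≡⟨ ∣tabulate∣ (λ k → does (P? (proj₁ (vertex k)) ×-dec Q? (proj₂ (vertex k)))) ⟩
    ∑[ k < n * m ] f (vertex k)
      ≡⟨ ∑-remQuot n m f ⟩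
    ∑[ j < n ] ∑[ i < m ] f (j , i)
      ≡⟨ sum-cong-≗ (λ j → sum-cong-≗ (λ i → indicator-∧ (does (P? j)) (does (Q? i)))) ⟩
    ∑[ j < n ] ∑[ i < m ] (p j * q i)
      ≡⟨ sum-cong-≗ (λ j → *-distribˡ-sum (p j) q) ⟨
    ∑[ j < n ] (p j * ∑[ i < m ] q i)
      ≡⟨ *-distribʳ-sum _ p ⟨
    ∑[ j < n ] p j * ∑[ i < m ] q i
      ≡⟨ cong₂ _*_ (∣tabulate∣ (does ∘ P?)) (∣tabulate∣ (does ∘ Q?)) ⟨
    ∣ P? ∣ᵖ * ∣ Q? ∣ᵖ ∎
    where
    open ≡-Reasoning
    p : Fin n → ℕ
    p = indicator ∘ does ∘ P?
    q : Fin m → ℕ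
    q = indicator ∘ does ∘ Q?
    f : Vertex → ℕ
    f (j , i) = indicator (does (P? j ×-dec Q? i))

  -- The cruder bound `n` instead of `n ∸ 1` makes each of the three terms of the lower bound equal
  -- to `n * m * ∣ A ∣`.
  ∣𝒩ʳ∣≤n : ∀ v → ∣ 𝒩ʳ v ∣ ≤ n
  ∣𝒩ʳ∣≤n (j , i) = begin
    ∣ 𝒩ʳ (j , i) ∣              ≡⟨ ∣rectangle∣ ≢j? (Fin._≟ i) ⟩
    ∣ ≢j? ∣ᵖ * ∣ Fin._≟ i ∣ᵖ    ≡⟨ cong (∣ ≢j? ∣ᵖ *_) (∣≟∣ i) ⟩
    ∣ ≢j? ∣ᵖ * 1                ≡⟨ *-identityʳ _ ⟩
    ∣ ≢j? ∣ᵖ                    ≤⟨ ∣p∣≤n (tabulate (does ∘ ≢j?)) ⟩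
    n                           ∎
    where
    open ≤-Reasoning
    ≢j? : Decidable (_≢ j)
    ≢j? j′ = ¬? (j′ Fin.≟ j)

  ∣𝒩ᶜ∣≤m : ∀ v → ∣ 𝒩ᶜ v ∣ ≤ m
  ∣𝒩ᶜ∣≤m (j , i) = begin
    ∣ 𝒩ᶜ (j , i) ∣              ≡⟨ ∣rectangle∣ (Fin._≟ j) ≢i? ⟩
    ∣ Fin._≟ j ∣ᵖ * ∣ ≢i? ∣ᵖ    ≡⟨ cong (_* ∣ ≢i? ∣ᵖ) (∣≟∣ j) ⟩
    1 * ∣ ≢i? ∣ᵖ                ≡⟨ *-identityˡ _ ⟩
    ∣ ≢i? ∣ᵖ                    ≤⟨ ∣p∣≤n (tabulate (does ∘ ≢i?)) ⟩
    m                           ∎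
    where
    open ≤-Reasoning
    ≢i? : Decidable (_≢ i)
    ≢i? i′ = ¬? (i′ Fin.≟ i)

  𝒩ʳ-sym : ∀ k l → lookup (𝒩ʳ (vertex k)) l ≡ lookup (𝒩ʳ (vertex l)) k
  𝒩ʳ-sym k l = trans (lookup∘tabulate _ l) (trans
    (does-⇔ (mk⇔ flip flip) (adjacent? k l) (adjacent? l k))
    (sym (lookup∘tabulate _ k)))
    where
    adjacent? : ∀ k l → Dec (proj₁ (vertex l) ≢ proj₁ (vertex k) × proj₂ (vertex l) ≡ proj₂ (vertex k))
    adjacent? k l = ¬? (proj₁ (vertex l) Fin.≟ proj₁ (vertex k)) ×-dec (proj₂ (vertex l) Fin.≟ proj₂ (vertex k))

    flip : ∀ {j j′ : Fin n} {i i′ : Fin m} → j′ ≢ j × i′ ≡ i → j ≢ j′ × i ≡ i′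
    flip (j′≢j , i′≡i) = ≢-sym j′≢j , sym i′≡i

  𝒩ᶜ-sym : ∀ k l → lookup (𝒩ᶜ (vertex k)) l ≡ lookup (𝒩ᶜ (vertex l)) k
  𝒩ᶜ-sym k l = trans (lookup∘tabulate _ l) (trans
    (does-⇔ (mk⇔ flip flip) (adjacent? k l) (adjacent? l k))
    (sym (lookup∘tabulate _ k)))
    where
    adjacent? : ∀ k l → Dec (proj₁ (vertex l) ≡ proj₁ (vertex k) × proj₂ (vertex l) ≢ proj₂ (vertex k))
    adjacent? k l = (proj₁ (vertex l) Fin.≟ proj₁ (vertex k)) ×-dec ¬? (proj₂ (vertex l) Fin.≟ proj₂ (vertex k))

    flip : ∀ {j j′ : Fin n} {i i′ : Fin m} → j′ ≡ j × i′ ≢ i → j ≡ j′ × i ≢ i′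
    flip (j′≡j , i′≢i) = sym j′≡j , ≢-sym i′≢i

  -- Spanning sets and the two bounds on `γ`

  module _ (Z : ZeroSet) where
    open ZeroSet Z using (Carrier; downward) renaming (_∈? to _∈Z?)

    Grows : VertexSet → Pred Vertex 0ℓ
    Grows A v = ¬ Carrier (∣ 𝒩ʳ v ∩ A ∣ , ∣ 𝒩ᶜ v ∩ A ∣)

    grows? : ∀ A → Decidable (Grows A)
    grows? A v = ¬? ((∣ 𝒩ʳ v ∩ A ∣ , ∣ 𝒩ᶜ v ∩ A ∣) ∈Z?)

    𝒯-spans⁺ : ∀ {A} → (∀ k → ¬ k ∈ A → Grows A (vertex k)) → 𝒯 Z A ≡ ⊤
    𝒯-spans⁺ {A} grows = ⊆-antisym ⊆⊤ λ {k} _ → x∈p∪q⁺ (reached k)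
      where
      reached : ∀ k → k ∈ A ⊎ k ∈ ∁ A ∩ ⟪ grows? A ⟫
      reached k with k ∈? A
      ... | yes k∈A = inj₁ k∈A
      ... | no  k∉A = inj₂ (x∈p∩q⁺ (x∉p⇒x∈∁p k∉A , ∈⟪⟫⁺ (grows? A) (grows k k∉A)))

    𝒯-spans⁻ : ∀ {A} → 𝒯 Z A ≡ ⊤ → ∀ k → k ∈ A ⊎ Grows A (vertex k)
    𝒯-spans⁻ {A} spans k with x∈p∪q⁻ A _ (subst (k ∈_) (sym spans) ∈⊤)
    ... | inj₁ k∈A = inj₁ k∈A
    ... | inj₂ k∈  = inj₂ (∈⟪⟫⁻ (grows? A) (proj₂ (x∈p∩q⁻ (∁ A) _ k∈)))

    γ≤nm : γ Z m n ≤ n * m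
    γ≤nm = proj₂ (proj₂ (γ-minimum Z m n)) (⊤ , ∣⊤∣≡n (n * m) , ∪-zeroˡ _)

    -- The witness `cross` is the union of the first `a` columns and the first `b` rows. A vertex
    -- outside it sees at least `a` members along its row and `b` along its column, so by downward
    -- closure its counts in `Carrier` would force `(a , b)` into `Carrier`.
    γ≤weight : ∀ {a b} → a ≤ n → b ≤ m → ¬ Carrier (a , b) → γ Z m n ≤ a * m + b * n
    γ≤weight {a} {b} a≤n b≤m ab∉Z =
      ≤-trans (proj₂ (proj₂ (γ-minimum Z m n)) (cross , refl , 𝒯-spans⁺ grows)) ∣cross∣≤
      where
      open ≤-Reasoning

      left? : Decidable (λ (j : Fin n) → toℕ j < a)
      left? j = toℕ j <? a

      low? : Decidable (λ (i : Fin m) → toℕ i < b)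
      low? i = toℕ i <? b

      cross? : Decidable (λ ((j , i) : Vertex) → toℕ j < a ⊎ toℕ i < b)
      cross? (j , i) = left? j ⊎-dec low? i

      columns? : Decidable (λ ((j , i) : Vertex) → toℕ j < a × U i)
      columns? (j , i) = left? j ×-dec U? i

      rows? : Decidable (λ ((j , i) : Vertex) → U j × toℕ i < b)
      rows? (j , i) = U? j ×-dec low? i

      cross : VertexSet
      cross = ⟪ cross? ⟫

      cross⊆ : cross ⊆ˢ ⟪ columns? ⟫ ∪ ⟪ rows? ⟫
      cross⊆ k∈ with ∈⟪⟫⁻ cross? k∈
      ... | inj₁ j<a = x∈p∪q⁺ (inj₁ (∈⟪⟫⁺ columns? (j<a , _)))
      ... | inj₂ i<b = x∈p∪q⁺ (inj₂ (∈⟪⟫⁺ rows? (_ , i<b)))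

      ∣cross∣≤ : ∣ cross ∣ ≤ a * m + b * n
      ∣cross∣≤ = begin
        ∣ cross ∣                            ≤⟨ p⊆q⇒∣p∣≤∣q∣ cross⊆ ⟩
        ∣ ⟪ columns? ⟫ ∪ ⟪ rows? ⟫ ∣         ≤⟨ ∣p∪q∣≤∣p∣+∣q∣ ⟪ columns? ⟫ ⟪ rows? ⟫ ⟩
        ∣ ⟪ columns? ⟫ ∣ + ∣ ⟪ rows? ⟫ ∣     ≡⟨ cong₂ _+_ (∣rectangle∣ left? U?) (∣rectangle∣ U? low?) ⟩
        ∣ left? ∣ᵖ * ∣ U? {A = Fin m} ∣ᵖ + ∣ U? {A = Fin n} ∣ᵖ * ∣ low? ∣ᵖ
          ≡⟨ cong₂ _+_ (cong₂ _*_ (∣<∣ a≤n) (∣U∣ m)) (cong₂ _*_ (∣U∣ n) (∣<∣ b≤m)) ⟩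
        a * m + n * b                        ≡⟨ cong (a * m +_) (*-comm n b) ⟩
        a * m + b * n                        ∎

      grows : ∀ k → ¬ k ∈ cross → Grows cross (vertex k)
      grows k k∉ z = ab∉Z (downward a≤ b≤ z)
        where
        j = proj₁ (vertex k)
        i = proj₂ (vertex k)

        rowPart? : Decidable (λ ((j′ , i′) : Vertex) → toℕ j′ < a × i′ ≡ i)
        rowPart? (j′ , i′) = left? j′ ×-dec (i′ Fin.≟ i)

        columnPart? : Decidable (λ ((j′ , i′) : Vertex) → j′ ≡ j × toℕ i′ < b)
        columnPart? (j′ , i′) = (j′ Fin.≟ j) ×-dec low? i′

        -- These vertices lie in the punctured row: one with column index `j` would give `toℕ j < a`
        -- and hence put `k` itself into `cross`.
        rowPart⊆ : ⟪ rowPart? ⟫ ⊆ˢ 𝒩ʳ (vertex k) ∩ cross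
        rowPart⊆ l∈ with j′<a , i′≡i ← ∈⟪⟫⁻ rowPart? l∈ = x∈p∩q⁺
          ( ∈⟪⟫⁺ (λ (j′ , i′) → ¬? (j′ Fin.≟ j) ×-dec (i′ Fin.≟ i))
              ((λ j′≡j → k∉ (∈⟪⟫⁺ cross? (inj₁ (subst (λ x → toℕ x < a) j′≡j j′<a)))) , i′≡i)
          , ∈⟪⟫⁺ cross? (inj₁ j′<a))

        columnPart⊆ : ⟪ columnPart? ⟫ ⊆ˢ 𝒩ᶜ (vertex k) ∩ cross
        columnPart⊆ l∈ with j′≡j , i′<b ← ∈⟪⟫⁻ columnPart? l∈ = x∈p∩q⁺
          ( ∈⟪⟫⁺ (λ (j′ , i′) → (j′ Fin.≟ j) ×-dec ¬? (i′ Fin.≟ i))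
              (j′≡j , λ i′≡i → k∉ (∈⟪⟫⁺ cross? (inj₂ (subst (λ x → toℕ x < b) i′≡i i′<b))))
          , ∈⟪⟫⁺ cross? (inj₂ i′<b))

        a≤ : a ≤ ∣ 𝒩ʳ (vertex k) ∩ cross ∣
        a≤ = begin
          a                            ≡⟨ *-identityʳ a ⟨
          a * 1                        ≡⟨ cong₂ _*_ (∣<∣ a≤n) (∣≟∣ i) ⟨
          ∣ left? ∣ᵖ * ∣ Fin._≟ i ∣ᵖ   ≡⟨ ∣rectangle∣ left? (Fin._≟ i) ⟨
          ∣ ⟪ rowPart? ⟫ ∣             ≤⟨ p⊆q⇒∣p∣≤∣q∣ rowPart⊆ ⟩
          ∣ 𝒩ʳ (vertex k) ∩ cross ∣    ∎

        b≤ : b ≤ ∣ 𝒩ᶜ (vertex k) ∩ cross ∣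
        b≤ = begin
          b                            ≡⟨ *-identityˡ b ⟨
          1 * b                        ≡⟨ cong₂ _*_ (∣≟∣ j) (∣<∣ b≤m) ⟨
          ∣ Fin._≟ j ∣ᵖ * ∣ low? ∣ᵖ    ≡⟨ ∣rectangle∣ (Fin._≟ j) low? ⟨
          ∣ ⟪ columnPart? ⟫ ∣          ≤⟨ p⊆q⇒∣p∣≤∣q∣ columnPart⊆ ⟩
          ∣ 𝒩ᶜ (vertex k) ∩ cross ∣    ∎

    -- Stated for any `M` below these weights, so that it applies directly to what the program's
    -- invariant guarantees. The local inequality is summed over all vertices, and the nonzero
    -- factor `n * m` is then cancelled.
    M≤3γ : .{{_ : NonZero (n * m)}} → ∀ {M} → M ≤ n * m →
           (∀ {a b} → a < n → b < m → ¬ Carrier (a , b) → M ≤ a * m + b * n) → M ≤ 3 * γ Z m n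
    M≤3γ {M} M≤nm M≤weight with A , ∣A∣≡γ , spans ← proj₁ (proj₂ (γ-minimum Z m n)) =
      *-cancelˡ-≤ (n * m) (begin
        n * m * M
          ≡⟨ ∑-const (n * m) M ⟨
        ∑[ k < n * m ] M
          ≤⟨ ∑-mono local ⟩
        ∑[ k < n * m ] (r k * m + c k * n + A⟨ k ⟩ * (n * m))
          ≡⟨ ∑-distrib-+ (λ k → r k * m + c k * n) (λ k → A⟨ k ⟩ * (n * m)) ⟩
        ∑[ k < n * m ] (r k * m + c k * n) + ∑[ k < n * m ] (A⟨ k ⟩ * (n * m))
          ≡⟨ cong (_+ ∑[ k < n * m ] (A⟨ k ⟩ * (n * m))) (∑-distrib-+ (λ k → r k * m) (λ k → c k * n)) ⟩
        ∑[ k < n * m ] (r k * m) + ∑[ k < n * m ] (c k * n) + ∑[ k < n * m ] (A⟨ k ⟩ * (n * m))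
          ≡⟨ cong₂ _+_ (cong₂ _+_ (*-distribʳ-sum m r) (*-distribʳ-sum n c)) (*-distribʳ-sum (n * m) A⟨_⟩) ⟨
        ∑[ k < n * m ] r k * m + ∑[ k < n * m ] c k * n + ∑[ k < n * m ] A⟨ k ⟩ * (n * m)
          ≤⟨ +-mono-≤ (+-mono-≤ (*-monoˡ-≤ m (∑-∣∩∣≤ (𝒩ʳ ∘ vertex) 𝒩ʳ-sym (∣𝒩ʳ∣≤n ∘ vertex) A))
                                (*-monoˡ-≤ n (∑-∣∩∣≤ (𝒩ᶜ ∘ vertex) 𝒩ᶜ-sym (∣𝒩ᶜ∣≤m ∘ vertex) A)))
                      (≤-reflexive (cong (_* (n * m)) (sym (∣p∣≡∑ A)))) ⟩
        n * ∣ A ∣ * m + m * ∣ A ∣ * n + ∣ A ∣ * (n * m)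
          ≡⟨ solve 3 (λ n m x → n :* x :* m :+ m :* x :* n :+ x :* (n :* m) := n :* m :* (con 3 :* x))
               refl n m ∣ A ∣ ⟩
        n * m * (3 * ∣ A ∣)
          ≡⟨ cong (λ x → n * m * (3 * x)) ∣A∣≡γ ⟩
        n * m * (3 * γ Z m n) ∎)
      where
      open ≤-Reasoning
      open +-*-Solver

      r c A⟨_⟩ : Fin (n * m) → ℕ
      r k = ∣ 𝒩ʳ (vertex k) ∩ A ∣
      c k = ∣ 𝒩ᶜ (vertex k) ∩ A ∣
      A⟨ k ⟩ = indicator (lookup A k)

      -- Extends the hypothesis beyond the rectangle: if `a ≥ n` or `b ≥ m`, the weight is already
      -- at least `n * m`. No strict bounds on `r k` and `c k` have to be proved.
      outside-weight : ∀ {a b} → ¬ Carrier (a , b) → M ≤ a * m + b * n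
      outside-weight {a} {b} ab∉Z with a <? n | b <? m
      ... | yes a<n | yes b<m = M≤weight a<n b<m ab∉Z
      ... | no  a≮n | _       =
        ≤-trans M≤nm (≤-trans (*-monoˡ-≤ m (≮⇒≥ a≮n)) (m≤m+n _ _))
      ... | yes _   | no b≮m  =
        ≤-trans M≤nm (≤-trans (≤-reflexive (*-comm n m)) (≤-trans (*-monoˡ-≤ n (≮⇒≥ b≮m)) (m≤n+m _ _)))

      local : ∀ k → M ≤ r k * m + c k * n + A⟨ k ⟩ * (n * m)
      local k with 𝒯-spans⁻ spans k
      ... | inj₂ grown = ≤-trans (outside-weight grown) (m≤m+n _ _)
      ... | inj₁ k∈A rewrite []=⇒lookup k∈A =
        ≤-trans M≤nm (≤-trans (≤-reflexive (sym (*-identityˡ (n * m)))) (m≤n+m _ (r k * m + c k * n)))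

-- Total correctness with upper bounds on the running time

Halts : Program → State → ℕ → Pred State 0ℓ → Set
Halts p s T Q = ∃ λ t → ∃ λ s′ → (p , s ⇓[ t ] s′) × t ≤ T × Q s′

halts-reg : ∀ {x e s Q} → Q (setReg x (⟦ e ⟧ s) s) → Halts (x ≔ e) s (1 + cost e) Q
halts-reg q = _ , _ , ⇓reg , ≤-refl , q

infixr 3 _halts-⨟_

_halts-⨟_ : ∀ {p q s T U Q W} → Halts p s T Q → (∀ {s′} → Q s′ → Halts q s′ U W) →
            Halts (p ⨟ q) s (T + U) W
(_ , _ , p⇓ , t≤T , q) halts-⨟ h with _ , _ , q⇓ , u≤U , w ← h q =
  _ , _ , ⇓seq p⇓ q⇓ , +-mono-≤ t≤T u≤U , w

-- Unlike `_halts-⨟_`, this keeps the explicit state after the assignment, so facts about the other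
-- registers carry over by computation.
halts-reg-⨟ : ∀ {x e q s U W} → Halts q (setReg x (⟦ e ⟧ s) s) U W →
              Halts ((x ≔ e) ⨟ q) s (1 + cost e + U) W
halts-reg-⨟ (_ , _ , q⇓ , u≤U , w) = _ , _ , ⇓seq ⇓reg q⇓ , +-monoʳ-≤ _ u≤U , w

-- The test value `N ∸ k` is nonzero exactly while `k < N`, so there are `N` rounds, followed by one
-- failing test that accounts for the last summand.
halts-while : ∀ {e p N T} (I : ℕ → Pred State 0ℓ) →
              (∀ {k s} → I k s → ⟦ e ⟧ s ≡ N ∸ k) →
              (∀ {k s} → k < N → I k s → Halts p s T (I (suc k))) →
              ∀ {s} → I 0 s → Halts (While e Do p) s (N * (1 + cost e + T) + (1 + cost e)) (I N)
halts-while {e} {p} {N} {T} I test body = go N 0 refl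
  where
  -- Recursion on the number `r` of rounds still to come.
  go : ∀ r k → k + r ≡ N → ∀ {s} → I k s →
       Halts (While e Do p) s (r * (1 + cost e + T) + (1 + cost e)) (I N)
  go zero k k+0≡N inv with refl ← trans (sym (+-identityʳ k)) k+0≡N =
    _ , _ , ⇓done (trans (test inv) (n∸n≡0 k)) , ≤-refl , inv
  go (suc r) k k+1+r≡N inv
    with k<N ← subst (k <_) k+1+r≡N (m<m+n k z<s)
    with _ , _ , p⇓ , t≤T , inv′ ← body k<N inv
    with _ , _ , w⇓ , u≤ , final ← go r (suc k) (trans (sym (+-suc k r)) k+1+r≡N) inv′ =
    _ , _ , ⇓while (λ e≡0 → m>n⇒m∸n≢0 k<N (trans (sym (test inv)) e≡0)) p⇓ w⇓
    , ≤-trans (+-mono-≤ (+-monoʳ-≤ (1 + cost e) t≤T) u≤)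
              (≤-reflexive (sym (+-assoc (1 + cost e + T) (r * (1 + cost e + T)) (1 + cost e))))
    , final

-- The program

-- Registers: 2 is the row y, 3 the column x, 4 the best weight so far, 5 is
-- y * n and 6 is x * m + y * n. The first loop computes the weight n * m.
countUp sweepRow visit search : Program
countUp  = While reg 0 ⊖ reg 2 Do (4 ≔ reg 4 ⊕ reg 1 ⨟ 2 ≔ reg 2 ⊕ const 1)
visit    = (If 0 [ reg 5 ⊕ reg 3 ] Then skip Else (4 ≔ reg 4 ⊖ (reg 4 ⊖ reg 6)))
         ⨟ 6 ≔ reg 6 ⊕ reg 0
         ⨟ 3 ≔ reg 3 ⊕ const 1
sweepRow = 3 ≔ const 0
         ⨟ 6 ≔ reg 5
         ⨟ (While reg 1 ⊖ reg 3 Do visit)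
         ⨟ 5 ≔ reg 5 ⊕ reg 1
         ⨟ 2 ≔ reg 2 ⊕ const 1
search   = countUp
         ⨟ 2 ≔ const 0
         ⨟ (While reg 0 ⊖ reg 2 Do sweepRow)
         ⨟ 0 ≔ reg 4

-- The machine has no minimum operation, so `visit` obtains it from truncated subtraction in this
-- form.
m∸[m∸n]≡m⊓n : ∀ m n → m ∸ (m ∸ n) ≡ m ⊓ n
m∸[m∸n]≡m⊓n m n with ≤-total m n
... | inj₁ m≤n = trans (cong (m ∸_) (m≤n⇒m∸n≡0 m≤n)) (sym (m≤n⇒m⊓n≡m m≤n))
... | inj₂ n≤m = trans (m∸[m∸n]≡n n≤m) (sym (m≥n⇒m⊓n≡n n≤m))

-- Invariants and cost of the program

module _ (m n : ℕ) .{{_ : NonZero n}} (Z : ZeroSet) where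
  open ZeroSet Z using (Carrier) renaming (_∈? to _∈Z?)

  table : ℕ → ℕ
  table = arrs (input m n Z) 0

  -- Division with remainder by `n` recovers `(x , y)` from the cell index, because `x < n`.
  table-cell : ∀ {x} y → x < n → table (y * n + x) ≡ indicator (does ((x , y) ∈Z?))
  table-cell {x} y x<n = cong₂ (λ a b → indicator (does ((a , b) ∈Z?))) column row
    where
    open ≡-Reasoning

    column : (y * n + x) % n ≡ x
    column = begin
      (y * n + x) % n  ≡⟨ cong (_% n) (+-comm (y * n) x) ⟩
      (x + y * n) % n  ≡⟨ [m+kn]%n≡m%n x y n ⟩
      x % n            ≡⟨ m<n⇒m%n≡m x<n ⟩
      x                ∎

    row : (y * n + x) / n ≡ y
    row = begin
      (y * n + x) / n    ≡⟨ +-distrib-/-∣ˡ x (n∣m*n y) ⟩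
      y * n / n + x / n  ≡⟨ cong₂ _+_ (m*n/n≡m y n) (m<n⇒m/n≡0 x<n) ⟩
      y + 0              ≡⟨ +-identityʳ y ⟩
      y                  ∎

  Scanned : ℕ → ℕ → Pred (ℕ × ℕ) 0ℓ
  Scanned y x (a , b) = (a < n × b < y) ⊎ (a < x × b ≡ y)

  -- `γ≤best` survives each update because every candidate weight is itself at least `γ`. The other
  -- two fields become the hypotheses of `M≤3γ` once the scan is complete.
  record Best (y x best : ℕ) : Set where
    field
      γ≤best      : γ Z m n ≤ best
      best≤nm     : best ≤ n * m
      best≤weight : ∀ {a b} → Scanned y x (a , b) → ¬ Carrier (a , b) → best ≤ a * m + b * n
  open Best

  best-init : Best 0 0 (n * m)
  best-init = record
    { γ≤best      = γ≤nm n m Z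
    ; best≤nm     = ≤-refl
    ; best≤weight = λ { (inj₁ ()) ; (inj₂ ()) }
    }

  -- Serves both branches of the test: `best′` is `best` if `(x , y)` is in `Carrier`, and the
  -- minimum of `best` and the new weight otherwise.
  best-step : ∀ {y x best best′} → γ Z m n ≤ best′ → best′ ≤ best →
              (¬ Carrier (x , y) → best′ ≤ x * m + y * n) →
              Best y x best → Best y (suc x) best′
  best-step {y} {x} {best} {best′} γ≤best′ best′≤best new b = record
    { γ≤best      = γ≤best′
    ; best≤nm     = ≤-trans best′≤best (best≤nm b)
    ; best≤weight = weight
    }
    where
    weight : ∀ {a b} → Scanned y (suc x) (a , b) → ¬ Carrier (a , b) → best′ ≤ a * m + b * n
    weight (inj₁ old) ∉Z = ≤-trans best′≤best (best≤weight b (inj₁ old) ∉Z)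
    weight (inj₂ (a<1+x , b≡y)) ∉Z with m≤n⇒m<n∨m≡n (s≤s⁻¹ a<1+x)
    ... | inj₁ a<x = ≤-trans best′≤best (best≤weight b (inj₂ (a<x , b≡y)) ∉Z)
    ... | inj₂ refl with refl ← b≡y = new ∉Z

  best-nextRow : ∀ {y best} → Best y n best → Best (suc y) 0 best
  best-nextRow {y} {best} b = record
    { γ≤best      = γ≤best b
    ; best≤nm     = best≤nm b
    ; best≤weight = λ { (inj₁ (a<n , b<1+y)) → best≤weight b (scanned a<n b<1+y) }
    }
    where
    scanned : ∀ {a b} → a < n → b < suc y → Scanned y n (a , b)
    scanned a<n b<1+y with m≤n⇒m<n∨m≡n (s≤s⁻¹ b<1+y)
    ... | inj₁ b<y = inj₁ (a<n , b<y)
    ... | inj₂ b≡y = inj₂ (a<n , b≡y)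

  -- Register 5 is carried along because the sweep relies on its initial value 0, which is `y * n`
  -- for the first row.
  record Counting (k : ℕ) (s : State) : Set where
    field
      reg0 : regs s 0 ≡ m
      reg1 : regs s 1 ≡ n
      reg2 : regs s 2 ≡ k
      reg4 : regs s 4 ≡ k * n
      reg5 : regs s 5 ≡ 0
      arr0 : arrs s 0 ≡ table

  -- The order of arguments lets `Searching 0` and `Visiting y` serve directly as invariants of the
  -- outer and the inner loop.
  record Searching (x y : ℕ) (s : State) : Set where
    field
      reg0 : regs s 0 ≡ m
      reg1 : regs s 1 ≡ n
      reg2 : regs s 2 ≡ y
      reg5 : regs s 5 ≡ y * n
      arr0 : arrs s 0 ≡ table
      best : Best y x (regs s 4)

  record Visiting (y x : ℕ) (s : State) : Set where
    field
      searching : Searching x y s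
      reg3      : regs s 3 ≡ x
      reg6      : regs s 6 ≡ x * m + y * n
    open Searching searching public

  countUp-halts : Halts countUp (input m n Z) (m * 12 + 4) (Counting m)
  countUp-halts = halts-while Counting
    (λ inv → let open Counting inv in cong₂ _∸_ reg0 reg2)
    (λ {k} _ inv → let open Counting inv in
      halts-reg-⨟ (halts-reg record
        { reg0 = reg0 ; reg1 = reg1
        ; reg2 = trans (cong (_+ 1) reg2) (+-comm k 1)
        ; reg4 = trans (cong₂ _+_ reg4 reg1) (+-comm (k * n) n)
        ; reg5 = reg5 ; arr0 = arr0 }))
    record { reg0 = refl ; reg1 = refl ; reg2 = refl ; reg4 = refl ; reg5 = refl ; arr0 = refl }

  -- The bound 19 is 11 for the conditional and 4 for each of the two increments.
  visit-halts : ∀ {y x s} → y < m → x < n → Visiting y x s → Halts visit s 19 (Visiting y (suc x))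
  visit-halts {y} {x} {s} y<m x<n inv = test halts-⨟ λ (b , r0 , r1 , r2 , r3 , r5 , r6 , a0) →
    halts-reg-⨟ (halts-reg record
      { searching = record { reg0 = r0 ; reg1 = r1 ; reg2 = r2 ; reg5 = r5 ; arr0 = a0 ; best = b }
      ; reg3 = trans (cong (_+ 1) r3) (+-comm x 1)
      ; reg6 = trans (cong₂ _+_ r6 r0)
                 (trans (+-comm (x * m + y * n) m) (sym (+-assoc m (x * m) (y * n)))) })
    where
    open Visiting inv

    -- Halfway through the round the best weight already accounts for `(x , y)`, while registers 3
    -- and 6 still hold the values for `x`.
    Tested : State → Set
    Tested s′ = Best y (suc x) (regs s′ 4) ×
      regs s′ 0 ≡ m × regs s′ 1 ≡ n × regs s′ 2 ≡ y × regs s′ 3 ≡ x × regs s′ 5 ≡ y * n ×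
      regs s′ 6 ≡ x * m + y * n × arrs s′ 0 ≡ table

    cell : arrs s 0 (regs s 5 + regs s 3) ≡ indicator (does ((x , y) ∈Z?))
    cell = trans (cong₂ (λ f k → f k) arr0 (cong₂ _+_ reg5 reg3)) (table-cell y x<n)

    test : Halts (If 0 [ reg 5 ⊕ reg 3 ] Then skip Else (4 ≔ reg 4 ⊖ (reg 4 ⊖ reg 6))) s 11 Tested
    test with (x , y) ∈Z? | cell
    ... | yes z | cell≡1 =
      _ , _ , ⇓then (λ cell≡0 → contradiction (trans (sym cell≡1) cell≡0) λ ()) ⇓skip
      -- The `skip` branch takes time 6, against 11 for the branch with the assignment.
      , m≤m+n 6 5
      , best-step (γ≤best best) ≤-refl (λ ∉Z → contradiction z ∉Z) best
      , reg0 , reg1 , reg2 , reg3 , reg5 , reg6 , arr0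
    ... | no ∉Z | cell≡0 =
      _ , _ , ⇓else cell≡0 ⇓reg , ≤-refl
      , subst (Best y (suc x)) (sym (m∸[m∸n]≡m⊓n (regs s 4) (regs s 6)))
          (best-step
            (⊓-glb (γ≤best best) (≤-trans (γ≤weight n m Z (<⇒≤ x<n) (<⇒≤ y<m) ∉Z) (≤-reflexive (sym reg6))))
            (m⊓n≤m _ _)
            (λ _ → ≤-trans (m⊓n≤n _ _) (≤-reflexive reg6))
            best)
      , reg0 , reg1 , reg2 , reg3 , reg5 , reg6 , arr0

  -- Each round of the inner loop costs 23: 4 for its test and 19 for `visit`.
  sweepRow-halts : ∀ {y s} → y < m → Searching 0 y s →
                   Halts sweepRow s (2 + (2 + (n * 23 + 4 + (4 + 4)))) (Searching 0 (suc y))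
  sweepRow-halts {y} {s} y<m inv =
    halts-reg-⨟ (halts-reg-⨟ (
    halts-while (Visiting y)
      (λ v → cong₂ _∸_ (Visiting.reg1 v) (Visiting.reg3 v))
      (visit-halts y<m)
      record
        { searching = record
            { reg0 = reg0 ; reg1 = reg1 ; reg2 = reg2 ; reg5 = reg5 ; arr0 = arr0 ; best = best }
        ; reg3 = refl
        ; reg6 = reg5 } halts-⨟ λ v →
    halts-reg-⨟ (halts-reg record
      { reg0 = Visiting.reg0 v
      ; reg1 = Visiting.reg1 v
      ; reg2 = trans (cong (_+ 1) (Visiting.reg2 v)) (+-comm y 1)
      ; reg5 = trans (cong₂ _+_ (Visiting.reg5 v) (Visiting.reg1 v)) (+-comm (y * n) n)
      ; arr0 = Visiting.arr0 v
      ; best = best-nextRow (Visiting.best v) })))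
    where open Searching inv

  search-halts : Halts search (input m n Z)
    (m * 12 + 4 + (2 + (m * (4 + (2 + (2 + (n * 23 + 4 + (4 + 4))))) + 4 + 2)))
    (λ s → Best m 0 (output s))
  search-halts =
    countUp-halts halts-⨟ λ c → let open Counting c in
    halts-reg-⨟ (
    halts-while (Searching 0)
      (λ s → cong₂ _∸_ (Searching.reg0 s) (Searching.reg2 s))
      sweepRow-halts
      record
        { reg0 = reg0 ; reg1 = reg1 ; reg2 = refl ; reg5 = reg5 ; arr0 = arr0
        ; best = subst (Best 0 0) (sym (trans reg4 (*-comm m n))) best-init } halts-⨟ λ s →
    halts-reg (Searching.best s))

-- The quadratic time bound and the approximation theorem

search-time≤ : ∀ {m n} .{{_ : NonZero n}} → m ≤ n →
  m * 12 + 4 + (2 + (m * (4 + (2 + (2 + (n * 23 + 4 + (4 + 4))))) + 4 + 2)) ≤ 67 * n ^ 2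
search-time≤ {m} {n@(suc k)} m≤n = begin
  m * 12 + 4 + (2 + (m * T + 4 + 2))
    ≤⟨ +-mono-≤ (+-monoˡ-≤ 4 (*-monoˡ-≤ 12 m≤n))
                (+-monoʳ-≤ 2 (+-monoˡ-≤ 2 (+-monoˡ-≤ 4 (*-monoˡ-≤ T m≤n)))) ⟩
  n * 12 + 4 + (2 + (n * T + 4 + 2))
    -- The time is now `23 * n ^ 2 + 32 * n + 12`, and 67 is the sum of its coefficients, enough
    -- since `n ≥ 1`. The added term is the exact slack, written in `k` with `n = suc k` to avoid
    -- subtraction.
    ≤⟨ m≤m+n _ (56 * k + 44 * (k * k)) ⟩
  n * 12 + 4 + (2 + (n * T + 4 + 2)) + (56 * k + 44 * (k * k))
    ≡⟨ solve 1 (λ k → let n = con 1 :+ k in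
         n :* con 12 :+ con 4 :+ (con 2 :+ (n :* (con 8 :+ (n :* con 23 :+ con 4 :+ con 8)) :+ con 4 :+ con 2))
           :+ (con 56 :* k :+ con 44 :* (k :* k))
         := con 67 :* (n :* (n :* con 1)))
       refl k ⟩
  67 * n ^ 2 ∎
  where
  open ≤-Reasoning
  open +-*-Solver
  T = 4 + (2 + (2 + (n * 23 + 4 + (4 + 4))))

theorem1p4 : ∃ λ (P : Program) → ∃ λ (c : ℕ) → ∃ λ (d : ℕ) →
    ∀ (m n : ℕ) .{{_ : NonZero m}} .{{_ : NonZero n}} → m ≤ n →
    (Z : ZeroSet) → ZeroSet.Carrier Z ⊆ R n m →
    ∃ λ (t : ℕ) → ∃ λ (s : State) →
    (P , input m n Z ⇓[ t ] s) × t ≤ c * n ^ d ×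
    γ Z m n ≤ output s × output s ≤ 3 * γ Z m n
theorem1p4 = search , 67 , 2 , λ m n m≤n Z _ →
  let t , s , run , t≤ , best = search-halts m n Z
      open Best best
  in t , s , run , ≤-trans t≤ (search-time≤ m≤n) , γ≤best ,
     -- After `m` complete rows, the `inj₁` case of `Scanned` covers every pair with `a < n` and
     -- `b < m`.
     M≤3γ n m Z {{m*n≢0 n m}} best≤nm (λ a<n b<m → best≤weight (inj₁ (a<n , b<m)))
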